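{- Let $k,t$ be integers with $2\leq k<t$, and let $G$ be the complete bipartite graph with classes $U=\{u_1,\ldots,u_t\}$ and $V=\{v_1,\ldots,v_k\}$. Then $pc_k(G)=t$ and $pvc_k(G)=2$.
   Context: All graphs are simple, finite and undirected. Colorings of edges or vertices are arbitrary (not required to be proper). A set of internally vertex-disjoint paths is called disjoint. A path in an edge-colored graph is a proper path if any two adjacent edges of the path differ in color. An edge-colored graph is proper $k$-connected if any two distinct vertices are connected by $k$ (distinct) disjoint proper paths. For a $k$-connected graph $G$, $pc_k(G)$ is the smallest number of colors required on the edges to make $G$ proper $k$-connected. A path in a vertex-colored graph is a vertex-proper path if any two adjacent internal vertices of the path differ in color (the end-vertices are not internal). A vertex-colored graph is proper vertex $k$-connected if any two distinct vertices are connected by $k$ (distinct) disjoint vertex-proper paths. For a $k$-connected graph $G$, $pvc_k(G)$ is the smallest number of colors required on the vertices to make $G$ proper vertex $k$-connected. -}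

module Defs where

open import Data.Empty using (⊥)
open import Data.Fin using (Fin)
open import Data.Fin.Properties using (+↔⊎)
open import Data.List using (List; []; _∷_)
open import Data.List.Relation.Binary.Disjoint.Propositional using (Disjoint)
open import Data.List.Relation.Unary.Linked using (Linked)
open import Data.List.Relation.Unary.Unique.Propositional using (Unique)
open import Data.Nat using (ℕ; _+_; _≤_)
open import Data.Product using (Σ; _×_)
open import Data.Sum using (_⊎_; inj₁; inj₂)
open import Data.Unit using (⊤; tt)
open import Function.Bundles using (_↔_)
open import Function.Properties.Inverse using (↔-sym)
open import Relation.Binary.Construct.Closure.ReflexiveTransitive using (Star; ε; _◅_)
open import Relation.Binary.Definitions using (Symmetric; Irreflexive; Decidable)
open import Relation.Binary.PropositionalEquality using (_≡_; _≢_; refl)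
open import Relation.Nullary using (yes; no)

record Graph : Set₁ where
  field
    Vertex  : Set
    order   : ℕ
    finite  : Vertex ↔ Fin order
    Adj     : Vertex → Vertex → Set
    adj?    : Decidable Adj
    symm    : Symmetric Adj
    irrefl  : Irreflexive _≡_ Adj

module _ (G : Graph) where
  open Graph G

  Walk : Vertex → Vertex → Set
  Walk = Star Adj

  -- The adjacency proof is irrelevant and the two orientations agree, so a
  -- colour is attached to the unordered edge {u, v}.
  record EdgeColoring (m : ℕ) : Set where
    field
      color      : ∀ {u v} → .(Adj u v) → Fin m
      color-symm : ∀ {u v} .(e : Adj u v) → color (symm e) ≡ color e

  VertexColoring : ℕ → Set
  VertexColoring m = Vertex → Fin m

module _ {G : Graph} where
  open Graph G

  vertices : ∀ {u v} → Walk G u v → List Vertex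
  vertices {u} ε       = u ∷ []
  vertices {u} (_ ◅ p) = u ∷ vertices p

  dropEnd : ∀ {u v} → Walk G u v → List Vertex
  dropEnd     ε       = []
  dropEnd {u} (_ ◅ p) = u ∷ dropEnd p

  internal : ∀ {u v} → Walk G u v → List Vertex
  internal ε       = []
  internal (_ ◅ p) = dropEnd p

  IsPath : ∀ {u v} → Walk G u v → Set
  IsPath p = Unique (vertices p)

  edgeColors : ∀ {m} → EdgeColoring G m → ∀ {u v} → Walk G u v → List (Fin m)
  edgeColors c ε       = []
  edgeColors c (e ◅ p) = EdgeColoring.color c e ∷ edgeColors c p

  IsProper : ∀ {m} → EdgeColoring G m → ∀ {u v} → Walk G u v → Set
  IsProper c p = Linked _≢_ (edgeColors c p)

  IsVertexProper : ∀ {m} → VertexColoring G m → ∀ {u v} → Walk G u v → Set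
  IsVertexProper c p = Linked (λ x y → c x ≢ c y) (internal p)

  -- Distinctness is a separate condition because a single-edge path has no
  -- internal vertices and is hence internally disjoint from itself.  It is
  -- measured on vertex sequences, so that different proofs of one adjacency
  -- do not count as different paths.
  DistinctDisjointPaths : ℕ → (∀ {u v} → Walk G u v → Set) →
                          Vertex → Vertex → Set
  DistinctDisjointPaths k Good u v =
    Σ (Fin k → Walk G u v) λ P →
      (∀ i → IsPath (P i) × Good (P i)) ×
      (∀ i j → i ≢ j → vertices (P i) ≢ vertices (P j) ×
                       Disjoint (internal (P i)) (internal (P j)))

  ProperConnected : ℕ → ∀ {m} → EdgeColoring G m → Set
  ProperConnected k c =
    ∀ u v → u ≢ v → DistinctDisjointPaths k (IsProper c) u v

  ProperVertexConnected : ℕ → ∀ {m} → VertexColoring G m → Set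
  ProperVertexConnected k c =
    ∀ u v → u ≢ v → DistinctDisjointPaths k (IsVertexProper c) u v

IsLeast : (ℕ → Set) → ℕ → Set
IsLeast P n = P n × (∀ m → P m → n ≤ m)

-- pc_k(G) and pvc_k(G) are partial (a suitable coloring need not exist), so
-- they are given as relations whose last argument is the value.
IsPc : ℕ → Graph → ℕ → Set
IsPc k G = IsLeast λ m → Σ (EdgeColoring G m) (ProperConnected k)

IsPvc : ℕ → Graph → ℕ → Set
IsPvc k G = IsLeast λ m → Σ (VertexColoring G m) (ProperVertexConnected {G} k)

module _ (t k : ℕ) where

  BipartiteAdj : Fin t ⊎ Fin k → Fin t ⊎ Fin k → Set
  BipartiteAdj (inj₁ _) (inj₁ _) = ⊥
  BipartiteAdj (inj₁ _) (inj₂ _) = ⊤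
  BipartiteAdj (inj₂ _) (inj₁ _) = ⊤
  BipartiteAdj (inj₂ _) (inj₂ _) = ⊥

  completeBipartite : Graph
  completeBipartite = record
    { Vertex = Fin t ⊎ Fin k
    ; order  = t + k
    ; finite = ↔-sym +↔⊎
    ; Adj    = BipartiteAdj
    ; adj?   = dec
    ; symm   = λ {x} {y} → sy x y
    ; irrefl = λ {x} {y} → ir x y
    }
    where
    dec : Decidable BipartiteAdj
    dec (inj₁ _) (inj₁ _) = no λ ()
    dec (inj₁ _) (inj₂ _) = yes tt
    dec (inj₂ _) (inj₁ _) = yes tt
    dec (inj₂ _) (inj₂ _) = no λ ()

    sy : ∀ x y → BipartiteAdj x y → BipartiteAdj y x
    sy (inj₁ _) (inj₂ _) _ = tt
    sy (inj₂ _) (inj₁ _) _ = tt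

    ir : ∀ x y → x ≡ y → BipartiteAdj x y → ⊥
    ir (inj₁ _) _ refl ()
    ir (inj₂ _) _ refl ()

{-# OPTIONS --safe #-}
-- For distinct u, u′ in U, each of the k disjoint u–u′ paths meets V and
-- |V| = k, so each meets V exactly once: the paths are u v u′, one for every v.
-- Properness then forces all t edges at a vertex of V to have different colours.
-- Conversely, colouring uₐvⱼ by a + j mod t makes adjacent edges different, and
-- colouring vertices by their class makes adjacent vertices different; in both
-- cases every path is proper. The k disjoint uₐ–vⱼ paths are the edge uₐvⱼ and
-- uₐ v u vⱼ, one for each v ≠ vⱼ, the u being distinct and ≠ uₐ;
-- this is possible because k < t. With one vertex colour the only proper uₐ–vⱼ
-- path is the edge, so two colours are necessary.
module Submission where

open import Defs
open import Data.Fin using (Fin; zero; suc; toℕ; fromℕ<; inject≤; punchIn; punchOut)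
open import Data.Fin.Properties
  using (_≟_; any?; toℕ<n; toℕ≤n; toℕ-injective; fromℕ<-injective; inject≤-injective;
         punchIn-injective; punchInᵢ≢i; punchOut-injective; injective⇒≤)
open import Data.List using (_∷_; [])
open import Data.List.Membership.Propositional using (_∈_)
open import Data.List.Properties using (∷-injectiveˡ; ∷-injectiveʳ)
open import Data.List.Relation.Binary.Disjoint.Propositional using (Disjoint)
open import Data.List.Relation.Unary.All using ([]; _∷_)
open import Data.List.Relation.Unary.AllPairs using ([]; _∷_)
open import Data.List.Relation.Unary.Any using (here; there)
open import Data.List.Relation.Unary.Linked using (Linked; []; [-]; _∷_)
open import Data.Nat using (ℕ; zero; suc; _+_; _∸_; _%_; _≤_; _<_; NonZero; z≤n; s≤s)
open import Data.Nat.DivMod using (m%n<n; m<n⇒m%n≡m; [m+n]%n≡m%n; %-distribˡ-+)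
open import Data.Nat.Properties
  using (+-assoc; +-comm; m+[n∸m]≡n; 1+n≰n; ≤-trans; n≤1+n)
open import Data.Product using (∃; _×_; _,_; proj₁; proj₂)
open import Data.Sum using (inj₁; inj₂)
open import Data.Sum.Properties using (inj₁-injective; inj₂-injective)
open import Data.Unit using (tt)
open import Function using (_∘_)
open import Function.Definitions using (Injective)
open import Relation.Binary.Construct.Closure.ReflexiveTransitive using (ε; _◅_)
open import Relation.Binary.PropositionalEquality
  using (_≡_; _≢_; refl; sym; trans; cong; subst; module ≡-Reasoning)
open import Relation.Nullary using (Dec; yes; no; contradiction)

-- Pigeonhole and cancellation modulo `d`.

injective⇒surjective : ∀ {n} (f : Fin n → Fin n) → Injective _≡_ _≡_ f →
                       ∀ y → ∃ λ x → f x ≡ y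
injective⇒surjective {suc n} f f-inj y with any? (λ x → f x ≟ y)
... | yes found = found
... | no  y∉f   =
  -- Closing the gap at the missed `y` would inject `Fin (suc n)` into `Fin n`.
  contradiction
    (injective⇒≤ {f = λ x → punchOut (y≢f x)}
                 (λ {x} {x′} → f-inj ∘ punchOut-injective (y≢f x) (y≢f x′)))
    1+n≰n
  where
  y≢f : ∀ x → y ≢ f x
  y≢f x y≡fx = y∉f (x , sym y≡fx)

-- Adding `d ∸ o` completes the shift by `o` to a full period; `o ≤ d` makes the truncated
-- difference a true complement.
%-cancelʳ-+ : ∀ {d m n o} .{{_ : NonZero d}} → m < d → n < d → o ≤ d →
              (m + o) % d ≡ (n + o) % d → m ≡ n
%-cancelʳ-+ {d} {m} {n} {o} m<d n<d o≤d eq = begin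
  m                                ≡⟨ shift m<d ⟨
  ((m + o) % d + (d ∸ o) % d) % d  ≡⟨ cong (λ r → (r + (d ∸ o) % d) % d) eq ⟩
  ((n + o) % d + (d ∸ o) % d) % d  ≡⟨ shift n<d ⟩
  n                                ∎
  where
  open ≡-Reasoning
  shift : ∀ {x} → x < d → ((x + o) % d + (d ∸ o) % d) % d ≡ x
  shift {x} x<d = begin
    ((x + o) % d + (d ∸ o) % d) % d  ≡⟨ %-distribˡ-+ (x + o) (d ∸ o) d ⟨
    (x + o + (d ∸ o)) % d            ≡⟨ cong (_% d) (+-assoc x o (d ∸ o)) ⟩
    (x + (o + (d ∸ o))) % d          ≡⟨ cong (λ r → (x + r) % d) (m+[n∸m]≡n o≤d) ⟩
    (x + d) % d                      ≡⟨ [m+n]%n≡m%n x d ⟩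
    x % d                            ≡⟨ m<n⇒m%n≡m x<d ⟩
    x                                ∎

-- Colourings for which every path is proper.

module _ (G : Graph) where
  open Graph G

  -- Disjointness and distinctness do not mention colours, so one family of paths serves both
  -- colourings.
  pathsGood : ∀ {k u v} (Good : ∀ {u v} → Walk G u v → Set) →
              (∀ {u v} (p : Walk G u v) → IsPath {G} p → Good p) →
              DistinctDisjointPaths {G} k (IsPath {G}) u v →
              DistinctDisjointPaths {G} k Good u v
  pathsGood Good good (P , path , disjoint) =
    P , (λ i → proj₁ (path i) , good (P i) (proj₁ (path i))) , disjoint

  -- A walk that turns back repeats an edge and its colour, so edges are compared only when `x ≢ z`;
  -- `IsPath` supplies this inequality.
  properColoring⇒IsProper :
    ∀ {m} (c : EdgeColoring G m) →
    (∀ {x y z} (e : Adj x y) (e′ : Adj y z) → x ≢ z →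
     EdgeColoring.color c e ≢ EdgeColoring.color c e′) →
    ∀ {u v} (p : Walk G u v) → IsPath {G} p → IsProper {G} c p
  properColoring⇒IsProper {G} c proper ε             _ = []
  properColoring⇒IsProper {G} c proper (_ ◅ ε)       _ = [-]
  properColoring⇒IsProper {G} c proper (e ◅ e′ ◅ ε)  ((_ ∷ x≢z ∷ _) ∷ _) =
    proper e e′ x≢z ∷ [-]
  properColoring⇒IsProper {G} c proper (e ◅ e′ ◅ p@(_ ◅ _)) ((_ ∷ x≢z ∷ _) ∷ path) =
    proper e e′ x≢z ∷ properColoring⇒IsProper {G} c proper (e′ ◅ p) path

  properColoring⇒Linked-dropEnd :
    ∀ {m} (c : VertexColoring G m) → (∀ {x y} → Adj x y → c x ≢ c y) →
    ∀ {u v} (p : Walk G u v) → Linked (λ x y → c x ≢ c y) (dropEnd {G} p)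
  properColoring⇒Linked-dropEnd c proper ε            = []
  properColoring⇒Linked-dropEnd c proper (_ ◅ ε)      = [-]
  properColoring⇒Linked-dropEnd c proper (e ◅ p@(_ ◅ _)) =
    proper e ∷ properColoring⇒Linked-dropEnd c proper p

  properColoring⇒IsVertexProper :
    ∀ {m} (c : VertexColoring G m) → (∀ {x y} → Adj x y → c x ≢ c y) →
    ∀ {u v} (p : Walk G u v) → IsVertexProper {G} c p
  properColoring⇒IsVertexProper c proper ε       = []
  properColoring⇒IsVertexProper c proper (_ ◅ p) = properColoring⇒Linked-dropEnd c proper p

-- Upper bounds: `k` disjoint paths between any two vertices.

module Connectivity (n k : ℕ) (k≤n : k ≤ n) where

  G : Graph
  G = completeBipartite (suc n) k

  open Graph G

  k≤1+n : k ≤ suc n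
  k≤1+n = ≤-trans k≤n (n≤1+n n)

  -- Skipping `a` leaves `n` vertices of `U`, enough for all `k` indices. This is where the
  -- strictness of `k < t` enters.
  avoiding : Fin (suc n) → Fin k → Fin (suc n)
  avoiding a l = punchIn a (inject≤ l k≤n)

  avoiding-injective : ∀ a {l l′} → avoiding a l ≡ avoiding a l′ → l ≡ l′
  avoiding-injective a {l} {l′} = inject≤-injective k≤n k≤n l l′ ∘ punchIn-injective a _ _

  avoiding≢ : ∀ a l → a ≢ avoiding a l
  avoiding≢ a l = punchInᵢ≢i a (inject≤ l k≤n) ∘ sym

  via : ∀ {x z} y → Adj x y → Adj y z → Walk G x z
  via y e e′ = _◅_ {j = y} e (e′ ◅ ε)

  via-isPath : ∀ {x z} y (e : Adj x y) (e′ : Adj y z) → x ≢ z → IsPath {G} (via y e e′)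
  via-isPath y e e′ x≢z =
    ((λ x≡y → irrefl x≡y e) ∷ x≢z ∷ []) ∷ ((λ y≡z → irrefl y≡z e′) ∷ []) ∷ [] ∷ []

  UU-paths : ∀ a b → a ≢ b → DistinctDisjointPaths {G} k (IsPath {G}) (inj₁ a) (inj₁ b)
  UU-paths a b a≢b =
    (λ l → via (inj₂ l) tt tt) ,
    (λ l → let path = via-isPath (inj₂ l) tt tt (a≢b ∘ inj₁-injective) in path , path) ,
    λ i j i≢j → (λ { refl → i≢j refl }) ,
                λ { (here refl , here refl) → i≢j refl }

  VV-paths : ∀ i j → i ≢ j → DistinctDisjointPaths {G} k (IsPath {G}) (inj₂ i) (inj₂ j)
  VV-paths i j i≢j =
    (λ l → via (inj₁ (inject≤ l k≤1+n)) tt tt) ,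
    (λ l → let path = via-isPath (inj₁ (inject≤ l k≤1+n)) tt tt (i≢j ∘ inj₂-injective) in path , path) ,
    λ l l′ l≢l′ →
      let u≢u′ = l≢l′ ∘ inject≤-injective k≤1+n k≤1+n l l′ in
      u≢u′ ∘ inj₁-injective ∘ ∷-injectiveˡ ∘ ∷-injectiveʳ ,
      λ { (here refl , here eq) → u≢u′ (inj₁-injective eq) }

  module UV (a : Fin (suc n)) (j : Fin k) where

    -- The decision is an argument, so that the lemmas below can match on it for two walks at once.
    UV-walk : ∀ l → Dec (l ≡ j) → Walk G (inj₁ a) (inj₂ j)
    UV-walk l (yes _) = tt ◅ ε
    UV-walk l (no _)  = _◅_ {j = inj₂ l} tt (via (inj₁ (avoiding a l)) tt tt)

    UV-isPath : ∀ l d → IsPath {G} (UV-walk l d)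
    UV-isPath l (yes _)  = ((λ ()) ∷ []) ∷ [] ∷ []
    UV-isPath l (no l≢j) =
      ((λ ()) ∷ avoiding≢ a l ∘ inj₁-injective ∷ (λ ()) ∷ []) ∷
      via-isPath (inj₁ _) tt tt (l≢j ∘ inj₂-injective)

    UV-distinct : ∀ l l′ d d′ → l ≢ l′ → vertices {G} (UV-walk l d) ≢ vertices {G} (UV-walk l′ d′)
    UV-distinct l l′ (yes refl) (yes refl) l≢l′ _  = l≢l′ refl
    UV-distinct l l′ (yes _)    (no _)     l≢l′ ()
    UV-distinct l l′ (no _)     (yes _)    l≢l′ ()
    UV-distinct l l′ (no _)     (no _)     l≢l′ eq =
      l≢l′ (inj₂-injective (∷-injectiveˡ (∷-injectiveʳ eq)))

    UV-disjoint : ∀ l l′ d d′ → l ≢ l′ →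
                  Disjoint (internal {G} (UV-walk l d)) (internal {G} (UV-walk l′ d′))
    UV-disjoint l l′ (yes _) _       l≢l′ (() , _)
    UV-disjoint l l′ (no _)  (yes _) l≢l′ (_ , ())
    UV-disjoint l l′ (no _)  (no _)  l≢l′ (here refl , here refl)         = l≢l′ refl
    UV-disjoint l l′ (no _)  (no _)  l≢l′ (here refl , there (here ()))
    UV-disjoint l l′ (no _)  (no _)  l≢l′ (there (here refl) , here ())
    UV-disjoint l l′ (no _)  (no _)  l≢l′ (there (here refl) , there (here eq)) =
      l≢l′ (avoiding-injective a (inj₁-injective eq))

    UV-paths : DistinctDisjointPaths {G} k (IsPath {G}) (inj₁ a) (inj₂ j)
    UV-paths =
      (λ l → UV-walk l (l ≟ j)) ,
      (λ l → UV-isPath l (l ≟ j) , UV-isPath l (l ≟ j)) ,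
      λ l l′ l≢l′ → UV-distinct l l′ (l ≟ j) (l′ ≟ j) l≢l′ ,
                    UV-disjoint l l′ (l ≟ j) (l′ ≟ j) l≢l′

    -- The reversals of the `UV-walk` paths, written out so that their vertex lists reduce directly.
    VU-walk : ∀ l → Dec (l ≡ j) → Walk G (inj₂ j) (inj₁ a)
    VU-walk l (yes _) = tt ◅ ε
    VU-walk l (no _)  = _◅_ {j = inj₁ (avoiding a l)} tt (via (inj₂ l) tt tt)

    VU-isPath : ∀ l d → IsPath {G} (VU-walk l d)
    VU-isPath l (yes _)  = ((λ ()) ∷ []) ∷ [] ∷ []
    VU-isPath l (no l≢j) =
      ((λ ()) ∷ l≢j ∘ sym ∘ inj₂-injective ∷ (λ ()) ∷ []) ∷
      via-isPath (inj₂ l) tt tt (avoiding≢ a l ∘ sym ∘ inj₁-injective)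

    VU-distinct : ∀ l l′ d d′ → l ≢ l′ → vertices {G} (VU-walk l d) ≢ vertices {G} (VU-walk l′ d′)
    VU-distinct l l′ (yes refl) (yes refl) l≢l′ _  = l≢l′ refl
    VU-distinct l l′ (yes _)    (no _)     l≢l′ ()
    VU-distinct l l′ (no _)     (yes _)    l≢l′ ()
    VU-distinct l l′ (no _)     (no _)     l≢l′ eq =
      l≢l′ (inj₂-injective (∷-injectiveˡ (∷-injectiveʳ (∷-injectiveʳ eq))))

    VU-disjoint : ∀ l l′ d d′ → l ≢ l′ →
                  Disjoint (internal {G} (VU-walk l d)) (internal {G} (VU-walk l′ d′))
    VU-disjoint l l′ (yes _) _       l≢l′ (() , _)
    VU-disjoint l l′ (no _)  (yes _) l≢l′ (_ , ())
    VU-disjoint l l′ (no _)  (no _)  l≢l′ (here refl , here eq) =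
      l≢l′ (avoiding-injective a (inj₁-injective eq))
    VU-disjoint l l′ (no _)  (no _)  l≢l′ (here refl , there (here ()))
    VU-disjoint l l′ (no _)  (no _)  l≢l′ (there (here refl) , here ())
    VU-disjoint l l′ (no _)  (no _)  l≢l′ (there (here refl) , there (here refl)) = l≢l′ refl

    VU-paths : DistinctDisjointPaths {G} k (IsPath {G}) (inj₂ j) (inj₁ a)
    VU-paths =
      (λ l → VU-walk l (l ≟ j)) ,
      (λ l → VU-isPath l (l ≟ j) , VU-isPath l (l ≟ j)) ,
      λ l l′ l≢l′ → VU-distinct l l′ (l ≟ j) (l′ ≟ j) l≢l′ ,
                    VU-disjoint l l′ (l ≟ j) (l′ ≟ j) l≢l′

  open UV

  connected : ∀ u v → u ≢ v → DistinctDisjointPaths {G} k (IsPath {G}) u v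
  connected (inj₁ a) (inj₁ b) u≢v = UU-paths a b (u≢v ∘ cong inj₁)
  connected (inj₁ a) (inj₂ j) _   = UV-paths a j
  connected (inj₂ j) (inj₁ a) _   = VU-paths a j
  connected (inj₂ i) (inj₂ j) u≢v = VV-paths i j (u≢v ∘ cong inj₂)

  -- The cyclic edge colouring and the colouring by classes.

  cyclic : Fin (suc n) → Fin k → Fin (suc n)
  cyclic a j = fromℕ< (m%n<n (toℕ a + toℕ j) (suc n))

  cyclic-mod : ∀ {a b i j} → cyclic a i ≡ cyclic b j →
               (toℕ a + toℕ i) % suc n ≡ (toℕ b + toℕ j) % suc n
  cyclic-mod = fromℕ<-injective _ _ _ _

  -- For two edges at a vertex of `V` the summand `toℕ j` is common and cancels. At a vertex of `U`
  -- the common summand is `toℕ a`, and `k ≤ suc n` keeps the indices from `V` below the modulus.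
  cyclic-injectiveˡ : ∀ {a b} j → cyclic a j ≡ cyclic b j → a ≡ b
  cyclic-injectiveˡ {a} {b} j eq =
    toℕ-injective (%-cancelʳ-+ (toℕ<n a) (toℕ<n b) (≤-trans (toℕ≤n j) k≤1+n)
                               (cyclic-mod {a} {b} {j} {j} eq))

  cyclic-injectiveʳ : ∀ a {i j} → cyclic a i ≡ cyclic a j → i ≡ j
  cyclic-injectiveʳ a {i} {j} eq =
    toℕ-injective (%-cancelʳ-+ (≤-trans (toℕ<n i) k≤1+n) (≤-trans (toℕ<n j) k≤1+n) (toℕ≤n a)
                               swapped)
    where
    swapped : (toℕ i + toℕ a) % suc n ≡ (toℕ j + toℕ a) % suc n
    swapped rewrite +-comm (toℕ i) (toℕ a) | +-comm (toℕ j) (toℕ a) =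
      cyclic-mod {a} {a} {i} {j} eq

  edgeColor : ∀ u v → .(Adj u v) → Fin (suc n)
  edgeColor (inj₁ a) (inj₂ j) _ = cyclic a j
  edgeColor (inj₂ j) (inj₁ a) _ = cyclic a j

  edgeColor-symm : ∀ u v .(e : Adj u v) → edgeColor v u (symm {u} {v} e) ≡ edgeColor u v e
  edgeColor-symm (inj₁ _) (inj₂ _) _ = refl
  edgeColor-symm (inj₂ _) (inj₁ _) _ = refl

  edgeColoring : EdgeColoring G (suc n)
  edgeColoring = record
    { color      = λ {u} {v} → edgeColor u v
    ; color-symm = λ {u} {v} → edgeColor-symm u v
    }

  edgeColor-proper : ∀ x y z (e : Adj x y) (e′ : Adj y z) → x ≢ z →
                     edgeColor x y e ≢ edgeColor y z e′
  edgeColor-proper (inj₁ a) (inj₂ j) (inj₁ b) _ _ x≢z =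
    x≢z ∘ cong inj₁ ∘ cyclic-injectiveˡ j
  edgeColor-proper (inj₂ i) (inj₁ a) (inj₂ j) _ _ x≢z =
    x≢z ∘ cong inj₂ ∘ cyclic-injectiveʳ a

  edgeColoring-connected : ProperConnected {G} k edgeColoring
  edgeColoring-connected u v u≢v =
    pathsGood G (IsProper {G} edgeColoring) (λ p path →
      properColoring⇒IsProper G edgeColoring (λ {x} {y} {z} → edgeColor-proper x y z) p path)
      (connected u v u≢v)

  sideColoring : VertexColoring G 2
  sideColoring (inj₁ _) = zero
  sideColoring (inj₂ _) = suc zero

  sideColoring-proper : ∀ x y → Adj x y → sideColoring x ≢ sideColoring y
  sideColoring-proper (inj₁ _) (inj₂ _) _ ()
  sideColoring-proper (inj₂ _) (inj₁ _) _ ()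

  sideColoring-connected : ProperVertexConnected {G} k sideColoring
  sideColoring-connected u v u≢v =
    pathsGood G (IsVertexProper {G} sideColoring) (λ p _ →
      properColoring⇒IsVertexProper G sideColoring (λ {x} {y} → sideColoring-proper x y) p)
      (connected u v u≢v)

-- Lower bounds.

module LowerBound (t k : ℕ) where

  G : Graph
  G = completeBipartite t k

  open Graph G

  module _ {a b : Fin t} (a≢b : a ≢ b) where

    -- The map from paths to `V` to which the pigeonhole principle is applied.
    firstV : Walk G (inj₁ a) (inj₁ b) → Fin k
    firstV ε                      = contradiction refl a≢b
    firstV (_◅_ {j = inj₂ l} _ _) = l

    firstV∈internal : ∀ p → inj₂ (firstV p) ∈ internal {G} p
    firstV∈internal ε                            = contradiction refl a≢b
    -- The walk ends in `U`, so it cannot stop at this vertex of `V`.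
    firstV∈internal (_◅_ {j = inj₂ _} _ (_ ◅ _)) = here refl

    module _ {m} (c : EdgeColoring G m) where
      open EdgeColoring c

      -- A path with more than two edges would visit a second vertex of `V`, internal because the
      -- path ends in `U`. Uniqueness would identify it with the first, which a path forbids. So
      -- there are two edges, and properness compares them.
      firstV-unique⇒colors-differ :
        ∀ p → IsPath {G} p → IsProper {G} c p →
        (∀ {x} → inj₂ x ∈ internal {G} p → x ≡ firstV p) →
        color {inj₁ a} {inj₂ (firstV p)} tt ≢ color {inj₁ b} {inj₂ (firstV p)} tt
      firstV-unique⇒colors-differ ε _ _ _ = contradiction refl a≢b
      firstV-unique⇒colors-differ (_◅_ {j = inj₂ l} _ (_◅_ {j = inj₁ _} _ ε)) _ (proper ∷ _) _ eq =
        -- The second edge is traversed from `V` to `U`; `color-symm` turns it around.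
        proper (trans eq (sym (color-symm {inj₁ b} {inj₂ l} tt)))
      firstV-unique⇒colors-differ
        (_◅_ {j = inj₂ l} _ (_◅_ {j = inj₁ _} _ (_◅_ {j = inj₂ x} _ (_ ◅ _))))
        (_ ∷ (_ ∷ l≢x ∷ _) ∷ _) _ unique _ =
        l≢x (cong inj₂ (sym (unique (there (there (here refl))))))

      -- Disjointness makes `firstV` injective on the `k` paths, hence onto the `k` vertices of `V`:
      -- some path starts through `l`, and no path has room for a second vertex of `V`.
      colors-differ : DistinctDisjointPaths {G} k (IsProper {G} c) (inj₁ a) (inj₁ b) → ∀ l →
                      color {inj₁ a} {inj₂ l} tt ≢ color {inj₁ b} {inj₂ l} tt
      colors-differ (P , good , disjoint) l =
        subst (λ l → color {inj₁ a} {inj₂ l} tt ≢ color {inj₁ b} {inj₂ l} tt) (proj₂ (hit l))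
          (firstV-unique⇒colors-differ (P i) (proj₁ (good i)) (proj₂ (good i)) unique)
        where
        shared⇒≡ : ∀ {i j x} → x ∈ internal {G} (P i) → x ∈ internal {G} (P j) → i ≡ j
        shared⇒≡ {i} {j} x∈i x∈j with i ≟ j
        ... | yes i≡j = i≡j
        ... | no  i≢j = contradiction (x∈i , x∈j) (proj₂ (disjoint i j i≢j))

        firstV-injective : Injective _≡_ _≡_ (firstV ∘ P)
        firstV-injective {i} {j} eq =
          shared⇒≡ (firstV∈internal (P i))
                   (subst (λ x → inj₂ x ∈ internal {G} (P j)) (sym eq) (firstV∈internal (P j)))

        hit : ∀ l → ∃ λ i → firstV (P i) ≡ l
        hit = injective⇒surjective (firstV ∘ P) firstV-injective

        i : Fin k
        i = proj₁ (hit l)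

        unique : ∀ {i x} → inj₂ x ∈ internal {G} (P i) → x ≡ firstV (P i)
        -- `x` is the first `V`-vertex of some path `j`; lying also on path `i`, it forces `j ≡ i`.
        unique {i} {x} x∈i with j , refl ← hit x =
          cong (firstV ∘ P) (shared⇒≡ (firstV∈internal (P j)) x∈i)

  edgeColors≥t : ∀ {m} (c : EdgeColoring G m) → Fin k → ProperConnected {G} k c → t ≤ m
  edgeColors≥t c l connected = injective⇒≤ {f = λ a → color {inj₁ a} {inj₂ l} tt} inj
    where
    open EdgeColoring c
    inj : Injective _≡_ _≡_ (λ a → color {inj₁ a} {inj₂ l} tt)
    inj {a} {b} eq with a ≟ b
    ... | yes a≡b = a≡b
    ... | no  a≢b =
      contradiction eq
        (colors-differ a≢b c (connected (inj₁ a) (inj₁ b) (a≢b ∘ inj₁-injective)) l)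

  Fin1-irrelevant : (i j : Fin 1) → i ≡ j
  Fin1-irrelevant zero zero = refl

  -- Any longer walk from `U` to `V` has at least three edges, hence two consecutive internal
  -- vertices, which share the only colour.
  monochromatic⇒edge : ∀ {a j} (c : VertexColoring G 1) (p : Walk G (inj₁ a) (inj₂ j)) →
                       IsVertexProper {G} c p → vertices {G} p ≡ inj₁ a ∷ inj₂ j ∷ []
  monochromatic⇒edge c (_ ◅ ε) _ = refl
  monochromatic⇒edge c (_◅_ {j = inj₂ _} _ (_◅_ {j = inj₁ _} _ (_ ◅ _))) (differ ∷ _) =
    contradiction (Fin1-irrelevant _ _) differ

  -- With one colour, two of the paths would both be the edge, against distinctness. With none, the
  -- vertex `a` cannot be coloured.
  vertexColors≥2 : ∀ {m} (c : VertexColoring G m) → Fin t → 2 ≤ k →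
                   ProperVertexConnected {G} k c → 2 ≤ m
  vertexColors≥2 {zero} c a _ _ with () ← c (inj₁ a)
  vertexColors≥2 {suc zero} c a (s≤s (s≤s _)) connected
    with P , good , disjoint ← connected (inj₁ a) (inj₂ zero) (λ ()) =
    contradiction (trans (edge zero) (sym (edge (suc zero))))
                  (proj₁ (disjoint zero (suc zero) (λ ())))
    where
    edge : ∀ i → vertices {G} (P i) ≡ inj₁ a ∷ inj₂ zero ∷ []
    edge i = monochromatic⇒edge c (P i) (proj₂ (good i))
  vertexColors≥2 {suc (suc _)} _ _ _ _ = s≤s (s≤s z≤n)

theorem5 : (k t : ℕ) → 2 ≤ k → k < t →
    IsPc k (completeBipartite t k) t × IsPvc k (completeBipartite t k) 2
-- Writing `t` as `suc n` turns `k < t` into `k ≤ n`; positivity of `k` and `t` yields the vertices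
-- `zero` used for the lower bounds.
theorem5 k@(suc _) t@(suc n) 2≤k (s≤s k≤n) =
  ((edgeColoring , edgeColoring-connected) ,
   λ _ (c , connected) → edgeColors≥t c zero connected) ,
  ((sideColoring , sideColoring-connected) ,
   λ _ (c , connected) → vertexColors≥2 c zero 2≤k connected)
  where
  open Connectivity n k k≤n hiding (G; connected)
  open LowerBound t k hiding (G)
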